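{- Let $q$ be a power of $2$, and let $L(x)=ax^q+bx$ with $a,b\in\mathbb F_{q^2}$. Let $\mathcal S(L)=\sum_{v\in\mathbb F_{q^2}}\chi(vL(v))$, where $\chi$ is the canonical additive character of $\mathbb F_{q^2}$. Then $\mathcal S(L)=0$ if and only if $a^q+a=0$ and $b\ne0$.
   Context: The canonical additive character of $\mathbb F_{q^2}$ ($q$ a power of $2$) is $\chi(v)=(-1)^{T(v)}$, where $T$ is the absolute trace map from $\mathbb F_{q^2}$ to $\mathbb F_2$. -}

module Defs where

open import Algebra.Bundles using (CommutativeRing; Semiring)
open import Algebra.Definitions using (Invertible)
import Algebra.Definitions.RawMonoid as RawMonoidDefs
import Algebra.Definitions.RawSemiring as RawSemiringDefs
open import Data.Bool.Base using (if_then_else_)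
open import Data.Fin.Base using (Fin; toℕ)
import Data.Fin.Properties as Fin
open import Data.Integer.Base as ℤ using (ℤ; -1ℤ)
open import Data.Nat.Base as ℕ using (ℕ)
open import Function.Bundles using (Inverse)
open import Function.Properties.Inverse using (Inverse⇒Injection)
open import Level using (Level; suc; _⊔_)
open import Relation.Binary.Definitions using (Decidable)
import Relation.Binary.PropositionalEquality as ≡
open import Relation.Nullary.Decidable using (via-injection; ⌊_⌋)
open import Relation.Nullary.Negation using (¬_)

-- A field with exactly n elements up to _≈_.
record FiniteField c ℓ (n : ℕ) : Set (suc (c ⊔ ℓ)) where
  field
    commutativeRing : CommutativeRing c ℓ

  open CommutativeRing commutativeRing public

  field
    1≉0           : ¬ (1# ≈ 0#)
    ≉0⇒invertible : ∀ x → ¬ (x ≈ 0#) → Invertible _≈_ 1# _*_ x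
    enumeration   : Inverse setoid (≡.setoid (Fin n))

  element : Fin n → Carrier
  element = Inverse.from enumeration

  infix 4 _≟_
  _≟_ : Decidable _≈_
  _≟_ = via-injection (Inverse⇒Injection enumeration) Fin._≟_

  open RawMonoidDefs +-rawMonoid public using (sum)
  open RawSemiringDefs (Semiring.rawSemiring semiring) public using (_^_)

-- The field 𝔽_{q²} for q = 2ᵐ. It has degree 2m over 𝔽₂; characteristic 2
-- follows from the number of elements.
module CharacterSum {c ℓ : Level} (m : ℕ)
  (F : FiniteField c ℓ ((2 ℕ.^ m) ℕ.^ 2)) where

  open FiniteField F

  q : ℕ
  q = 2 ℕ.^ m

  -- T v = v + v² + v⁴ + ⋯ + v^(2^(2m-1)), an element of the prime subfield.
  T : Carrier → Carrier
  T v = sum {2 ℕ.* m} λ i → v ^ (2 ℕ.^ toℕ i)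

  -- The identification of the prime subfield {0#, 1#} with the exponents
  -- {0, 1}. It is only applied to values of T, so the value at elements
  -- outside the prime subfield is immaterial.
  exponent : Carrier → ℕ
  exponent t = if ⌊ t ≟ 0# ⌋ then 0 else 1

  χ : Carrier → ℤ
  χ v = -1ℤ ℤ.^ exponent (T v)

  L : Carrier → Carrier → Carrier → Carrier
  L a b x = a * x ^ q + b * x

  open RawMonoidDefs ℤ.+-0-rawMonoid using () renaming (sum to sumℤ)

  𝒮 : (Carrier → Carrier) → ℤ
  𝒮 f = sumℤ λ i → χ (element i * f (element i))

{-# OPTIONS --safe #-}

-- Write c = a^q + a and ψ v = χ (v L(v)).  Since T is invariant under Frobenius,
-- ψ (v + u) = ψ v ψ u χ (c u^q v).  If c ≠ 0, summing ψ v ψ (v + u) over all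
-- u and v first over v leaves only the term u = 0, because a nontrivial
-- additive character sums to zero; hence 𝒮² = q² ≠ 0.  If c = 0, then
-- x = a v^(q+1) lies in 𝔽_q, so T x = 2 T_{𝔽_q} x = 0, and with β² = b the sum
-- becomes Σ χ (β v), which is zero exactly when b ≠ 0.  That T is not
-- identically zero follows by counting roots.
module Submission where

open import Defs
open import Algebra.Bundles using (CommutativeMonoid; CommutativeRing)
import Algebra.Definitions.RawMonoid as RawMonoidDefs
import Algebra.Properties.CommutativeMonoid.Sum as CommutativeMonoidSum
import Algebra.Properties.CommutativeSemiring.Exp as CommutativeSemiringExp
import Algebra.Properties.AbelianGroup as AbelianGroupProperties
import Algebra.Properties.Semiring.Mult as SemiringMult
import Algebra.Properties.Semiring.Sum as SemiringSum
import Algebra.Solver.Ring.NaturalCoefficients.Default as NaturalSolver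
open import Data.Bool.Base using (if_then_else_)
open import Data.Fin.Base using (Fin; zero; suc; toℕ)
open import Data.Fin.Permutation using (permutation)
import Data.Fin.Properties as Fin
open import Data.Integer.Base as ℤ using (ℤ; 0ℤ; 1ℤ; -1ℤ)
import Data.Integer.Properties as ℤ
open import Data.Nat.Base as ℕ using (ℕ; NonZero) renaming (_^_ to _^ℕ_)
import Data.Nat.Properties as ℕ
open import Data.Product.Base using (_×_; _,_; ∃; ∃₂)
open import Data.Sum.Base using (_⊎_; inj₁; inj₂)
open import Function.Base using (_∘_; case_of_; id)
open import Function.Bundles using (_⇔_; Inverse; mk⇔)
open import Level using (_⊔_)
open import Relation.Binary.PropositionalEquality as ≡ using (_≡_; _≢_)
import Relation.Binary.Reasoning.Setoid as SetoidReasoning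
open import Relation.Nullary.Decidable using (yes; no; ⌊_⌋)
open import Relation.Nullary.Negation using (¬_; contradiction)

i≡-i⇒i≡0 : ∀ {i} → i ≡ ℤ.- i → i ≡ 0ℤ
-- Negation exchanges the two constructors on every nonzero integer, so only zero remains as a case.
i≡-i⇒i≡0 {ℤ.+ ℕ.zero} _ = ≡.refl

module _ {a ℓ} (M : CommutativeMonoid a ℓ) where
  open CommutativeMonoid M
  open CommutativeMonoidSum M

  sum-single : ∀ {n} (t : Fin n → Carrier) i → (∀ j → j ≢ i → t j ≈ ε) → sum t ≈ t i
  sum-single {ℕ.suc n} t zero others = trans
    (∙-congˡ (trans (sum-cong-≋ (λ j → others (suc j) (λ ()))) (sum-replicate-zero n)))
    (identityʳ _)
  sum-single t (suc i) others = trans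
    (∙-cong (others zero (λ ()))
            (sum-single (t ∘ suc) i (λ j j≢i → others (suc j) (j≢i ∘ Fin.suc-injective))))
    (identityˡ _)

-- Monic polynomial functions and the number of their roots.

module MonicPolynomial {c ℓ} (R : CommutativeRing c ℓ) where
  open CommutativeRing R hiding (zero)
  open AbelianGroupProperties +-abelianGroup using (//-rightDividesˡ; x∙y⁻¹≈ε⇒x≈y)
  open NaturalSolver commutativeSemiring
  open SetoidReasoning setoid

  -- Horner form, stated for the induced function because only values at ring elements are needed.
  -- The degree belongs to the chosen presentation: over a finite field one function can be monic in
  -- several degrees.
  Monic : ℕ → (Carrier → Carrier) → Set (c ⊔ ℓ)
  Monic ℕ.zero    f = ∀ x → f x ≈ 1#
  Monic (ℕ.suc d) f = ∃₂ λ g r → Monic d g × (∀ x → f x ≈ x * g x + r)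

  Monic-resp : ∀ d {f g} → (∀ x → f x ≈ g x) → Monic d f → Monic d g
  Monic-resp ℕ.zero    f≈g monic = λ x → trans (sym (f≈g x)) (monic x)
  Monic-resp (ℕ.suc d) f≈g (h , r , monic , eq) = h , r , monic , λ x → trans (sym (f≈g x)) (eq x)

  -- The leading term comes from `f` alone, since `g` has one degree less. The quotients in `factor`
  -- have this shape.
  Monic-+-scaled : ∀ d {f g} s → Monic (ℕ.suc d) f → Monic d g → Monic (ℕ.suc d) (λ x → f x + s * g x)
  Monic-+-scaled ℕ.zero {f} {g} s (f′ , r , f′-monic , f-eq) g-monic =
    f′ , r + s , f′-monic , λ x → begin
      f x + s * g x              ≈⟨ +-cong (f-eq x) (*-congˡ (g-monic x)) ⟩
      (x * f′ x + r) + s * 1#    ≈⟨ solve 3 (λ p r s → (p :+ r) :+ s :* con 1 := p :+ (r :+ s)) refl (x * f′ x) r s ⟩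
      x * f′ x + (r + s)         ∎
  Monic-+-scaled (ℕ.suc d) {f} {g} s (f′ , r , f′-monic , f-eq) (g′ , r′ , g′-monic , g-eq) =
    _ , r + s * r′ , Monic-+-scaled d s f′-monic g′-monic , λ x → begin
      f x + s * g x
        ≈⟨ +-cong (f-eq x) (*-congˡ (g-eq x)) ⟩
      (x * f′ x + r) + s * (x * g′ x + r′)
        ≈⟨ solve 6 (λ x p r s q r′ → (x :* p :+ r) :+ s :* (x :* q :+ r′)
             := x :* (p :+ s :* q) :+ (r :+ s :* r′)) refl x (f′ x) r s (g′ x) r′ ⟩
      x * (f′ x + s * g′ x) + (r + s * r′)
        ∎

  -- Synthetic division by `x - s`. Writing `x` as `(x - s) + s` in `x * g x + r` and dividing `g`
  -- recursively gives the quotient `g + s * h` and the remainder `s * g s + r`, which is `f s`.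
  factor : ∀ d {f} s → Monic (ℕ.suc d) f → ∃ λ h → Monic d h × (∀ x → f x ≈ (x - s) * h x + f s)
  factor ℕ.zero {f} s (g , r , g-monic , f-eq) = g , g-monic , λ x → begin
    f x                              ≈⟨ f-eq x ⟩
    x * g x + r                      ≈⟨ +-congʳ (*-congʳ (//-rightDividesˡ s x)) ⟨
    (x - s + s) * g x + r            ≈⟨ +-congʳ (distribʳ _ _ _) ⟩
    (x - s) * g x + s * g x + r      ≈⟨ +-congʳ (+-congˡ (*-congˡ (trans (g-monic x) (sym (g-monic s))))) ⟩
    (x - s) * g x + s * g s + r      ≈⟨ +-assoc _ _ _ ⟩
    (x - s) * g x + (s * g s + r)    ≈⟨ +-congˡ (f-eq s) ⟨
    (x - s) * g x + f s              ∎
  factor (ℕ.suc d) {f} s (g , r , g-monic , f-eq)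
    with h , h-monic , g-eq ← factor d s g-monic =
    _ , Monic-+-scaled d s g-monic h-monic , λ x → begin
    f x                                        ≈⟨ f-eq x ⟩
    x * g x + r                                ≈⟨ +-congʳ (*-congʳ (//-rightDividesˡ s x)) ⟨
    (x - s + s) * g x + r                      ≈⟨ +-congʳ (distribʳ _ _ _) ⟩
    (x - s) * g x + s * g x + r                ≈⟨ +-congʳ (+-congˡ (*-congˡ (g-eq x))) ⟩
    (x - s) * g x + s * ((x - s) * h x + g s) + r
      ≈⟨ solve 6 (λ y p s q g r → y :* p :+ s :* (y :* q :+ g) :+ r
           := y :* (p :+ s :* q) :+ (s :* g :+ r)) refl (x - s) (g x) s (h x) (g s) r ⟩
    (x - s) * (g x + s * h x) + (s * g s + r)  ≈⟨ +-congˡ (f-eq s) ⟨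
    (x - s) * (g x + s * h x) + f s            ∎

  module _ (1≉0 : ¬ 1# ≈ 0#) (cancel : ∀ {x y} → ¬ x ≈ 0# → x * y ≈ 0# → y ≈ 0#) where

    -- Divide by `x - e zero`. The other points differ from `e zero`, so by `cancel` they are roots
    -- of the quotient, whose degree is one less; a constant `1#` has no root.
    roots≤degree : ∀ d {f k} (e : Fin k → Carrier) → (∀ {i j} → e i ≈ e j → i ≡ j) →
                   Monic d f → (∀ i → f (e i) ≈ 0#) → k ℕ.≤ d
    roots≤degree d         {k = ℕ.zero}  e e-inj monic roots = ℕ.z≤n
    roots≤degree ℕ.zero    {k = ℕ.suc k} e e-inj monic roots =
      contradiction (trans (sym (monic _)) (roots zero)) 1≉0
    roots≤degree (ℕ.suc d) {f} {ℕ.suc k} e e-inj monic roots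
      with h , h-monic , f-eq ← factor d (e zero) monic =
      ℕ.s≤s (roots≤degree d (e ∘ suc) (Fin.suc-injective ∘ e-inj) h-monic λ i →
        cancel (λ eq → case e-inj (x∙y⁻¹≈ε⇒x≈y _ _ eq) of λ ()) (begin
          (e (suc i) - e zero) * h (e (suc i))             ≈⟨ +-identityʳ _ ⟨
          (e (suc i) - e zero) * h (e (suc i)) + 0#        ≈⟨ +-congˡ (roots zero) ⟨
          (e (suc i) - e zero) * h (e (suc i)) + f (e zero) ≈⟨ f-eq _ ⟨
          f (e (suc i))                                    ≈⟨ roots (suc i) ⟩
          0#                                               ∎))

-- Sums over all elements of a finite field.

module FieldSum {c ℓ n} (F : FiniteField c ℓ n) {a r} (M : CommutativeMonoid a r) where
  open FiniteField F using (Carrier; _≈_; setoid; element; enumeration; _+_; -_)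
  private module F = FiniteField F
  private module M = CommutativeMonoid M
  open CommutativeMonoidSum M
  open RawMonoidDefs M.rawMonoid using () renaming (_×_ to _·_)
  open Inverse enumeration using (to; from; to-cong; strictlyInverseˡ; strictlyInverseʳ)

  -- The target monoid is a parameter so that the same lemmas serve integer sums, sums in the field
  -- and products in the field.
  ∑ : (Carrier → M.Carrier) → M.Carrier
  ∑ f = sum (f ∘ element)

  ∑-cong : ∀ {f g} → (∀ v → f v M.≈ g v) → ∑ f M.≈ ∑ g
  ∑-cong f≈g = sum-cong-≋ (f≈g ∘ element)

  ∑-distrib : ∀ f g → ∑ (λ v → f v M.∙ g v) M.≈ ∑ f M.∙ ∑ g
  ∑-distrib f g = ∑-distrib-+ (f ∘ element) (g ∘ element)

  ∑-swap : ∀ (f : Carrier → Carrier → M.Carrier) → ∑ (λ v → ∑ (f v)) M.≈ ∑ (λ w → ∑ (λ v → f v w))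
  ∑-swap f = ∑-comm (λ i j → f (element i) (element j))

  ∑-const : ∀ x → ∑ (λ _ → x) M.≈ n · x
  ∑-const x = sum-replicate n

  module _ {f : Carrier → M.Carrier} (f-cong : ∀ {v w} → v ≈ w → f v M.≈ f w) where

    -- Conjugating `σ` with the enumeration gives a permutation of the indices. The enumeration is
    -- inverse only up to `≈` on the field side, hence the congruence hypotheses.
    ∑-reindex : (σ τ : Carrier → Carrier) →
                (∀ {v w} → v ≈ w → σ v ≈ σ w) → (∀ {v w} → v ≈ w → τ v ≈ τ w) →
                (∀ v → σ (τ v) ≈ v) → (∀ v → τ (σ v) ≈ v) →
                ∑ f M.≈ ∑ (f ∘ σ)
    ∑-reindex σ τ σ-cong τ-cong στ τσ = M.trans
      (sum-permute (f ∘ element) (permutation (to ∘ σ ∘ from) (to ∘ τ ∘ from)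
        (inverse σ τ σ-cong στ) (inverse τ σ τ-cong τσ)))
      (sum-cong-≋ λ i → f-cong (strictlyInverseʳ (σ (from i))))
      where
      inverse : ∀ (σ τ : Carrier → Carrier) → (∀ {v w} → v ≈ w → σ v ≈ σ w) → (∀ v → σ (τ v) ≈ v) →
                ∀ i → to (σ (from (to (τ (from i))))) ≡ i
      inverse σ τ σ-cong στ i = ≡.trans
        (to-cong (F.trans (σ-cong (strictlyInverseʳ _)) (στ _))) (strictlyInverseˡ i)

    ∑-translate : ∀ u → ∑ f M.≈ ∑ (λ v → f (v + u))
    ∑-translate u = ∑-reindex (_+ u) (_+ - u) F.+-congʳ F.+-congʳ (//-rightDividesˡ u) (//-rightDividesʳ u)
      where open AbelianGroupProperties F.+-abelianGroup using (//-rightDividesˡ; //-rightDividesʳ)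

    ∑-single : ∀ w → (∀ v → ¬ v ≈ w → f v M.≈ M.ε) → ∑ f M.≈ f w
    ∑-single w others = M.trans
      (sum-single M (f ∘ element) (to w) λ i i≢w → others (from i) λ eq →
        i≢w (≡.trans (≡.sym (strictlyInverseˡ i)) (to-cong eq)))
      (f-cong (strictlyInverseʳ w))

-- Cancellation, the identity `x ^ n ≈ x`, and the characteristic.

module FiniteFieldProperties {c ℓ n} (F : FiniteField c ℓ n) where
  open FiniteField F hiding (zero)
  open CommutativeSemiringExp commutativeSemiring using (^-congˡ)
  open SetoidReasoning setoid

  *-cancelˡ-≉0 : ∀ {x y z} → ¬ x ≈ 0# → x * y ≈ x * z → y ≈ z
  *-cancelˡ-≉0 {x} {y} {z} x≉0 eq with x⁻¹ , x⁻¹x≈1 , _ ← ≉0⇒invertible x x≉0 = begin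
    y              ≈⟨ *-identityˡ y ⟨
    1# * y         ≈⟨ *-congʳ x⁻¹x≈1 ⟨
    x⁻¹ * x * y    ≈⟨ *-assoc _ _ _ ⟩
    x⁻¹ * (x * y)  ≈⟨ *-congˡ eq ⟩
    x⁻¹ * (x * z)  ≈⟨ *-assoc _ _ _ ⟨
    x⁻¹ * x * z    ≈⟨ *-congʳ x⁻¹x≈1 ⟩
    1# * z         ≈⟨ *-identityˡ z ⟩
    z              ∎

  xy≈0⇒y≈0 : ∀ {x y} → ¬ x ≈ 0# → x * y ≈ 0# → y ≈ 0#
  xy≈0⇒y≈0 x≉0 eq = *-cancelˡ-≉0 x≉0 (trans eq (sym (zeroʳ _)))

  *-≉0 : ∀ {x y} → ¬ x ≈ 0# → ¬ y ≈ 0# → ¬ x * y ≈ 0#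
  *-≉0 x≉0 y≉0 = y≉0 ∘ xy≈0⇒y≈0 x≉0

  ^-≉0 : ∀ {x} k → ¬ x ≈ 0# → ¬ x ^ k ≈ 0#
  ^-≉0 ℕ.zero    x≉0 = 1≉0
  ^-≉0 (ℕ.suc k) x≉0 = *-≉0 x≉0 (^-≉0 k x≉0)

  private module Π = FieldSum F *-commutativeMonoid
  open Π using () renaming (∑ to ∏)
  open CommutativeMonoidSum *-commutativeMonoid using () renaming (sum to product)

  product-≉0 : ∀ {k} (t : Fin k → Carrier) → (∀ i → ¬ t i ≈ 0#) → ¬ product t ≈ 0#
  product-≉0 {ℕ.zero}  t t≉0 = 1≉0
  product-≉0 {ℕ.suc k} t t≉0 = *-≉0 (t≉0 zero) (product-≉0 (t ∘ suc) (t≉0 ∘ suc))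

  -- Lets a product over the nonzero elements be written as a product over the whole field, with the
  -- factor `1#` at zero.
  if-zero : Carrier → Carrier → Carrier → Carrier
  if-zero v x y = if ⌊ v ≟ 0# ⌋ then x else y

  if-zero-yes : ∀ {v x y} → v ≈ 0# → if-zero v x y ≡ x
  if-zero-yes {v} v≈0 with v ≟ 0#
  ... | yes _  = ≡.refl
  ... | no v≉0 = contradiction v≈0 v≉0

  if-zero-no : ∀ {v x y} → ¬ v ≈ 0# → if-zero v x y ≡ y
  if-zero-no {v} v≉0 with v ≟ 0#
  ... | yes v≈0 = contradiction v≈0 v≉0
  ... | no _    = ≡.refl

  if-zero-cong : ∀ {v w x y x′ y′} → v ≈ w → x ≈ x′ → y ≈ y′ → if-zero v x y ≈ if-zero w x′ y′
  if-zero-cong {v} {w} v≈w x≈x′ y≈y′ with v ≟ 0# | w ≟ 0#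
  ... | yes _   | yes _   = x≈x′
  ... | no _    | no _    = y≈y′
  ... | yes v≈0 | no w≉0  = contradiction (trans (sym v≈w) v≈0) w≉0
  ... | no v≉0  | yes w≈0 = contradiction (trans v≈w w≈0) v≉0

  -- Multiplication by x permutes the nonzero elements, so it preserves their product.
  ∏-scale : ∀ {x} → ¬ x ≈ 0# → ∏ (λ v → if-zero v 1# x) ≈ 1#
  ∏-scale {x} x≉0 with x⁻¹ , x⁻¹x≈1 , xx⁻¹≈1 ← ≉0⇒invertible x x≉0 =
    *-cancelˡ-≉0 (product-≉0 _ unit≉0) (begin
      ∏ unit * ∏ scale              ≈⟨ Π.∑-distrib unit scale ⟨
      ∏ (λ v → unit v * scale v)    ≈⟨ Π.∑-cong unit*scale ⟩
      ∏ (λ v → unit (x * v))        ≈⟨ Π.∑-reindex (λ v≈w → if-zero-cong v≈w refl v≈w)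
                                         (x *_) (x⁻¹ *_) *-congˡ *-congˡ
                                         (cancels xx⁻¹≈1) (cancels x⁻¹x≈1) ⟨
      ∏ unit                        ≈⟨ *-identityʳ _ ⟨
      ∏ unit * 1#                   ∎)
    where
    unit scale : Carrier → Carrier
    unit v  = if-zero v 1# v
    scale v = if-zero v 1# x

    cancels : ∀ {y z} → y * z ≈ 1# → ∀ v → y * (z * v) ≈ v
    cancels yz≈1 v = trans (sym (*-assoc _ _ _)) (trans (*-congʳ yz≈1) (*-identityˡ v))

    unit≉0 : ∀ i → ¬ unit (element i) ≈ 0#
    unit≉0 i with element i ≟ 0#
    ... | yes _  = 1≉0
    ... | no v≉0 = v≉0

    unit*scale : ∀ v → unit v * scale v ≈ unit (x * v)
    unit*scale v with v ≟ 0#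
    ... | yes v≈0 = trans (*-identityˡ 1#)
                      (reflexive (≡.sym (if-zero-yes (trans (*-congˡ v≈0) (zeroʳ x)))))
    ... | no v≉0  = trans (*-comm v x) (reflexive (≡.sym (if-zero-no (*-≉0 x≉0 v≉0))))

  -- For nonzero `x`, split the product of `n` copies of `x` over the field: the factors at nonzero
  -- elements multiply to `1#` by `∏-scale`, and the factor at zero leaves one `x`.
  x^n≈x : ∀ x → x ^ n ≈ x
  x^n≈x x with x ≟ 0#
  ... | yes x≈0 = begin
    x ^ n   ≈⟨ ^-congˡ n x≈0 ⟩
    -- The index of `0#` witnesses that `n` is positive; the power with exponent 0 would be `1#`.
    0# ^ n  ≈⟨ 0^n≈0 (Inverse.to enumeration 0#) ⟩
    0#      ≈⟨ x≈0 ⟨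
    x       ∎
    where
    0^n≈0 : ∀ {k} → Fin k → 0# ^ k ≈ 0#
    0^n≈0 {ℕ.suc k} _ = zeroˡ _
  ... | no x≉0 = begin
    x ^ n                                          ≈⟨ Π.∑-const x ⟨
    ∏ (λ _ → x)                                    ≈⟨ Π.∑-cong split ⟩
    ∏ (λ v → if-zero v 1# x * if-zero v x 1#)      ≈⟨ Π.∑-distrib (λ v → if-zero v 1# x) (λ v → if-zero v x 1#) ⟩
    ∏ (λ v → if-zero v 1# x) * ∏ (λ v → if-zero v x 1#)
      ≈⟨ *-cong (∏-scale x≉0) (Π.∑-single (λ v≈w → if-zero-cong v≈w refl refl) 0#
           (λ v v≉0 → reflexive (if-zero-no v≉0))) ⟩
    1# * if-zero 0# x 1#                           ≈⟨ *-identityˡ _ ⟩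
    if-zero 0# x 1#                                ≡⟨ if-zero-yes refl ⟩
    x                                              ∎
    where
    split : ∀ v → x ≈ if-zero v 1# x * if-zero v x 1#
    split v with v ≟ 0#
    ... | yes _ = sym (*-identityˡ x)
    ... | no _  = sym (*-identityʳ x)

  open SemiringMult semiring using (×1-homo-*) renaming (_×_ to _·_)

  -- Translation by 1 permutes the field, so the sum of all elements absorbs n · 1.
  n·1≈0 : n · 1# ≈ 0#
  n·1≈0 = +-cancelˡ (∑ id) _ _ (begin
    ∑ id + n · 1#         ≈⟨ +-congˡ (∑-const 1#) ⟨
    ∑ id + ∑ (λ _ → 1#)   ≈⟨ ∑-distrib id _ ⟨
    ∑ (λ v → v + 1#)      ≈⟨ ∑-translate (λ v≈w → v≈w) 1# ⟨
    ∑ id                  ≈⟨ +-identityʳ _ ⟨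
    ∑ id + 0#             ∎)
    where
    open FieldSum F +-commutativeMonoid
    open AbelianGroupProperties +-abelianGroup using () renaming (∙-cancelˡ to +-cancelˡ)

  2^k·1 : ∀ k → (2 ^ℕ k) · 1# ≈ (1# + 1#) ^ k
  2^k·1 ℕ.zero    = +-identityʳ 1#
  2^k·1 (ℕ.suc k) = trans (×1-homo-* 2 (2 ^ℕ k)) (*-cong (+-congˡ (+-identityʳ 1#)) (2^k·1 k))

  -- The power `(1# + 1#) ^ k` equals `n · 1#`, which is zero, whereas powers of a nonzero element
  -- are nonzero.
  n≡2^k⇒1+1≈0 : ∀ {k} → n ≡ 2 ^ℕ k → 1# + 1# ≈ 0#
  n≡2^k⇒1+1≈0 {k} n≡2^k with (1# + 1#) ≟ 0#
  ... | yes 1+1≈0 = 1+1≈0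
  ... | no 1+1≉0  = contradiction
    (trans (sym (2^k·1 k)) (≡.subst (λ n → n · 1# ≈ 0#) n≡2^k n·1≈0)) (^-≉0 k 1+1≉0)

-- Frobenius and the absolute trace in characteristic 2.

module TraceProperties {c ℓ} (m : ℕ) .{{_ : NonZero m}} (F : FiniteField c ℓ ((2 ^ℕ m) ^ℕ 2)) where
  open FiniteField F hiding (zero)
  open CharacterSum m F
  open FiniteFieldProperties F
  open MonicPolynomial commutativeRing using (Monic; Monic-resp; roots≤degree)
  open SemiringSum semiring using (sum-cong-≋; ∑-distrib-+)
  open CommutativeSemiringExp commutativeSemiring
    using (^-congˡ; ^-congʳ; ^-assocʳ; ^-distrib-*)
  open AbelianGroupProperties +-abelianGroup using () renaming (∙-cancelʳ to +-cancelʳ)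
  open NaturalSolver commutativeSemiring
  open SetoidReasoning setoid

  private
    -- The last summand of `T` has exponent `2 ^ℕ k`, so this power of 2 is the degree of `T`;
    -- raising to it also inverts squaring. As `m` is nonzero, the predecessor is a true one.
    k : ℕ
    k = ℕ.pred (2 ℕ.* m)

    1+k≡2m : ℕ.suc k ≡ 2 ℕ.* m
    1+k≡2m = ℕ.suc-pred (2 ℕ.* m) {{ℕ.m*n≢0 2 m}}

  order : (2 ^ℕ m) ^ℕ 2 ≡ 2 ^ℕ (2 ℕ.* m)
  order = ≡.trans (ℕ.^-*-assoc 2 m 2) (≡.cong (2 ^ℕ_) (ℕ.*-comm m 2))

  x+x≈0 : ∀ x → x + x ≈ 0#
  x+x≈0 x = begin
    x + x            ≈⟨ solve 1 (λ x → x :+ x := (con 1 :+ con 1) :* x) refl x ⟩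
    (1# + 1#) * x    ≈⟨ *-congʳ (n≡2^k⇒1+1≈0 {2 ℕ.* m} order) ⟩
    0# * x           ≈⟨ zeroˡ x ⟩
    0#               ∎

  x+y≈0⇒x≈y : ∀ {x y} → x + y ≈ 0# → x ≈ y
  x+y≈0⇒x≈y {x} {y} x+y≈0 = +-cancelʳ y x y (trans x+y≈0 (sym (x+x≈0 y)))

  x^2^2m≈x : ∀ x → x ^ (2 ^ℕ (2 ℕ.* m)) ≈ x
  x^2^2m≈x x = trans (^-congʳ x (≡.sym order)) (x^n≈x x)

  x^q^q≈x : ∀ x → (x ^ q) ^ q ≈ x
  x^q^q≈x x = trans (^-assocʳ x q q) (trans
    (^-congʳ x (≡.cong (q ℕ.*_) (≡.sym (ℕ.*-identityʳ q)))) (x^n≈x x))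

  square-+ : ∀ x y → (x + y) ^ 2 ≈ x ^ 2 + y ^ 2
  square-+ x y = begin
    (x + y) ^ 2
      ≈⟨ solve 2 (λ x y → (x :+ y) :* ((x :+ y) :* con 1)
           := (x :* (x :* con 1) :+ y :* (y :* con 1)) :+ (x :* y :+ x :* y)) refl x y ⟩
    x ^ 2 + y ^ 2 + (x * y + x * y)   ≈⟨ +-congˡ (x+x≈0 _) ⟩
    x ^ 2 + y ^ 2 + 0#                ≈⟨ +-identityʳ _ ⟩
    x ^ 2 + y ^ 2                     ∎

  frobenius-+ : ∀ j x y → (x + y) ^ (2 ^ℕ j) ≈ x ^ (2 ^ℕ j) + y ^ (2 ^ℕ j)
  frobenius-+ ℕ.zero    x y = trans (*-identityʳ _) (sym (+-cong (*-identityʳ x) (*-identityʳ y)))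
  frobenius-+ (ℕ.suc j) x y = begin
    (x + y) ^ (2 ^ℕ ℕ.suc j)                     ≈⟨ ^-assocʳ (x + y) 2 (2 ^ℕ j) ⟨
    ((x + y) ^ 2) ^ (2 ^ℕ j)                     ≈⟨ ^-congˡ (2 ^ℕ j) (square-+ x y) ⟩
    (x ^ 2 + y ^ 2) ^ (2 ^ℕ j)                   ≈⟨ frobenius-+ j _ _ ⟩
    (x ^ 2) ^ (2 ^ℕ j) + (y ^ 2) ^ (2 ^ℕ j)      ≈⟨ +-cong (^-assocʳ x 2 (2 ^ℕ j)) (^-assocʳ y 2 (2 ^ℕ j)) ⟩
    x ^ (2 ^ℕ ℕ.suc j) + y ^ (2 ^ℕ ℕ.suc j)      ∎

  -- `T` is the case `2 ℕ.* m`. A variable length permits induction and the splitting of `T` into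
  -- blocks.
  trace : ℕ → Carrier → Carrier
  trace j v = sum {j} λ i → v ^ (2 ^ℕ toℕ i)

  trace-cong : ∀ j {v w} → v ≈ w → trace j v ≈ trace j w
  trace-cong j v≈w = sum-cong-≋ λ (i : Fin j) → ^-congˡ (2 ^ℕ toℕ i) v≈w

  trace-suc : ∀ j v → trace (ℕ.suc j) v ≈ v + trace j (v ^ 2)
  trace-suc j v = +-cong (*-identityʳ v)
    (sum-cong-≋ λ (i : Fin j) → sym (^-assocʳ v 2 (2 ^ℕ toℕ i)))

  -- The conjugates of `v` from position `i` on are the conjugates of `v ^ (2 ^ℕ i)`.
  trace-+ : ∀ i j v → trace (i ℕ.+ j) v ≈ trace i v + trace j (v ^ (2 ^ℕ i))
  trace-+ ℕ.zero    j v = trans (trace-cong j (sym (*-identityʳ v))) (sym (+-identityˡ _))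
  trace-+ (ℕ.suc i) j v = begin
    trace (ℕ.suc i ℕ.+ j) v                                    ≈⟨ trace-suc (i ℕ.+ j) v ⟩
    v + trace (i ℕ.+ j) (v ^ 2)                                ≈⟨ +-congˡ (trace-+ i j (v ^ 2)) ⟩
    v + (trace i (v ^ 2) + trace j ((v ^ 2) ^ (2 ^ℕ i)))       ≈⟨ +-assoc _ _ _ ⟨
    v + trace i (v ^ 2) + trace j ((v ^ 2) ^ (2 ^ℕ i))
      ≈⟨ +-cong (sym (trace-suc i v)) (trace-cong j (^-assocʳ v 2 (2 ^ℕ i))) ⟩
    trace (ℕ.suc i) v + trace j (v ^ (2 ^ℕ ℕ.suc i))           ∎

  trace-additive : ∀ j v w → trace j (v + w) ≈ trace j v + trace j w
  trace-additive j v w = trans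
    (sum-cong-≋ λ (i : Fin j) → frobenius-+ (toℕ i) v w)
    (∑-distrib-+ {j} (λ i → v ^ (2 ^ℕ toℕ i)) (λ i → w ^ (2 ^ℕ toℕ i)))

  trace-square : ∀ j v → trace j (v ^ 2) ≈ trace j v ^ 2
  trace-square ℕ.zero    v = sym (zeroˡ _)
  trace-square (ℕ.suc j) v = begin
    trace (ℕ.suc j) (v ^ 2)              ≈⟨ trace-suc j (v ^ 2) ⟩
    v ^ 2 + trace j ((v ^ 2) ^ 2)        ≈⟨ +-congˡ (trace-square j (v ^ 2)) ⟩
    v ^ 2 + trace j (v ^ 2) ^ 2          ≈⟨ square-+ _ _ ⟨
    (v + trace j (v ^ 2)) ^ 2            ≈⟨ ^-congˡ 2 (trace-suc j v) ⟨
    trace (ℕ.suc j) v ^ 2                ∎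

  T-cong : ∀ {v w} → v ≈ w → T v ≈ T w
  T-cong = trace-cong (2 ℕ.* m)

  T-+ : ∀ v w → T (v + w) ≈ T v + T w
  T-+ = trace-additive (2 ℕ.* m)

  -- Split the trace of length `2m + 1` at either end: removing the first summand leaves
  -- `T (v ^ 2)`, removing the last leaves `T v`, and both removed summands equal `v`.
  T-square : ∀ v → T (v ^ 2) ≈ T v
  T-square v = +-cancelʳ v _ _ (begin
    T (v ^ 2) + v                                   ≈⟨ +-comm _ _ ⟩
    v + T (v ^ 2)                                   ≈⟨ trace-suc (2 ℕ.* m) v ⟨
    trace (1 ℕ.+ 2 ℕ.* m) v                         ≡⟨ ≡.cong (λ j → trace j v) (ℕ.+-comm 1 (2 ℕ.* m)) ⟩
    trace (2 ℕ.* m ℕ.+ 1) v                         ≈⟨ trace-+ (2 ℕ.* m) 1 v ⟩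
    T v + trace 1 (v ^ (2 ^ℕ (2 ℕ.* m)))            ≈⟨ +-congˡ (trans (+-identityʳ _) (*-identityʳ _)) ⟩
    T v + v ^ (2 ^ℕ (2 ℕ.* m))                      ≈⟨ +-congˡ (x^2^2m≈x v) ⟩
    T v + v                                         ∎)

  T-frobenius : ∀ j v → T (v ^ (2 ^ℕ j)) ≈ T v
  T-frobenius ℕ.zero    v = T-cong (*-identityʳ v)
  T-frobenius (ℕ.suc j) v = begin
    T (v ^ (2 ^ℕ ℕ.suc j))     ≈⟨ T-cong (^-assocʳ v 2 (2 ^ℕ j)) ⟨
    T ((v ^ 2) ^ (2 ^ℕ j))     ≈⟨ T-frobenius j (v ^ 2) ⟩
    T (v ^ 2)                  ≈⟨ T-square v ⟩
    T v                        ∎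

  -- The trace value equals its own square, so a nonzero one cancels to `1#`.
  T≈0⊎T≈1 : ∀ v → T v ≈ 0# ⊎ T v ≈ 1#
  T≈0⊎T≈1 v with T v ≟ 0#
  ... | yes Tv≈0 = inj₁ Tv≈0
  ... | no Tv≉0  = inj₂ (*-cancelˡ-≉0 Tv≉0 (begin
    T v * T v    ≈⟨ *-congˡ (*-identityʳ _) ⟨
    T v ^ 2      ≈⟨ trace-square (2 ℕ.* m) v ⟨
    T (v ^ 2)    ≈⟨ T-square v ⟩
    T v          ≈⟨ *-identityʳ _ ⟨
    T v * 1#     ∎))

  -- The `2m` conjugates form two blocks of length `m`, the second being the first taken at `v ^ q`.
  -- On the subfield the blocks agree and cancel.
  T-subfield : ∀ v → v ^ q ≈ v → T v ≈ 0#
  T-subfield v v^q≈v = begin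
    T v                                      ≈⟨ trace-+ m (m ℕ.+ 0) v ⟩
    trace m v + trace (m ℕ.+ 0) (v ^ q)      ≡⟨ ≡.cong (λ j → trace m v + trace j (v ^ q)) (ℕ.+-identityʳ m) ⟩
    trace m v + trace m (v ^ q)              ≈⟨ +-congˡ (trace-cong m v^q≈v) ⟩
    trace m v + trace m v                    ≈⟨ x+x≈0 _ ⟩
    0#                                       ∎

  -- The degree of the trace polynomial, and an element of trace 1.

  Monic-∘-square : ∀ d {f} → Monic d f → Monic (d ℕ.+ d) (λ v → f (v ^ 2))
  Monic-∘-square ℕ.zero    monic = λ v → monic (v ^ 2)
  Monic-∘-square (ℕ.suc d) {f} (g , r , g-monic , f-eq) =
    ≡.subst (λ e → Monic (ℕ.suc e) (λ v → f (v ^ 2))) (≡.sym (ℕ.+-suc d d))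
      -- Substituting `v ^ 2` turns each Horner step into two, the inner one with constant term
      -- `0#`.
      (_ , r , (_ , 0# , Monic-∘-square d g-monic , λ v → sym (+-identityʳ _)) , λ v → begin
        f (v ^ 2)                      ≈⟨ f-eq (v ^ 2) ⟩
        v ^ 2 * g (v ^ 2) + r          ≈⟨ solve 3 (λ v p r → (v :* (v :* con 1)) :* p :+ r
                                            := v :* (v :* p) :+ r) refl v (g (v ^ 2)) r ⟩
        v * (v * g (v ^ 2)) + r        ∎)

  -- From degree 2 on, adding `v` changes only the linear coefficient, here from `s` to `s + 1#`.
  Monic-+-identity : ∀ d {f} → Monic (2 ℕ.+ d) f → Monic (2 ℕ.+ d) (λ v → v + f v)
  Monic-+-identity d {f} (g , r , (h , s , h-monic , g-eq) , f-eq) =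
    _ , r , (h , s + 1# , h-monic , λ v → refl) , λ v → begin
      v + f v                          ≈⟨ +-congˡ (f-eq v) ⟩
      v + (v * g v + r)                ≈⟨ +-congˡ (+-congʳ (*-congˡ (g-eq v))) ⟩
      v + (v * (v * h v + s) + r)      ≈⟨ solve 4 (λ v p s r → v :+ (v :* (v :* p :+ s) :+ r)
                                            := v :* (v :* p :+ (s :+ con 1)) :+ r) refl v (h v) s r ⟩
      v * (v * h v + (s + 1#)) + r     ∎

  -- By `trace-suc`, lengthening the trace by one substitutes `v ^ 2`, which doubles the degree, and
  -- then adds `v`.
  trace-monic : ∀ j → Monic (2 ^ℕ j) (trace (ℕ.suc j))
  trace-monic ℕ.zero    = _ , 0# , (λ v → refl) , λ v → refl
  trace-monic (ℕ.suc j) with 2 ^ℕ j | trace-monic j | ℕ.m^n>0 2 j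
  -- Positivity of `2 ^ℕ j` shows the doubled degree to be at least 2, as `Monic-+-identity`
  -- requires.
  ... | ℕ.suc d | monic | _ =
    ≡.subst (λ e → Monic (ℕ.suc e) (trace (2 ℕ.+ j)))
      (≡.trans (≡.sym (ℕ.+-suc d d)) (≡.cong (d ℕ.+_) (≡.sym (ℕ.+-identityʳ (ℕ.suc d)))))
      (Monic-resp (2 ℕ.+ (d ℕ.+ d)) (λ v → sym (trace-suc (ℕ.suc j) v))
        (Monic-+-identity (d ℕ.+ d)
          (≡.subst (λ e → Monic (ℕ.suc e) (λ v → trace (ℕ.suc j) (v ^ 2))) (ℕ.+-suc d d)
            (Monic-∘-square (ℕ.suc d) monic))))

  -- Otherwise `T` would vanish at all `2 ^ℕ (2 ℕ.* m)` elements, twice as many as its degree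
  -- `2 ^ℕ k`.
  T-surjective : ∃ λ w → T w ≈ 1#
  T-surjective with Fin.any? (λ i → T (element i) ≟ 1#)
  ... | yes (i , Tw≈1) = element i , Tw≈1
  ... | no T≉1 = contradiction
    (roots≤degree 1≉0 xy≈0⇒y≈0 (2 ^ℕ k) element element-injective
      (≡.subst (λ j → Monic (2 ^ℕ k) (trace j)) 1+k≡2m (trace-monic k))
      T-vanishes)
    (ℕ.<⇒≱ (≡.subst (2 ^ℕ k ℕ.<_) (≡.trans (≡.cong (2 ^ℕ_) 1+k≡2m) (≡.sym order))
      (ℕ.^-monoʳ-< 2 ℕ.≤-refl (ℕ.n<1+n k))))
    where
    element-injective : ∀ {i j} → element i ≈ element j → i ≡ j
    element-injective eq = ≡.trans (≡.sym (strictlyInverseˡ _)) (≡.trans (to-cong eq) (strictlyInverseˡ _))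
      where open Inverse enumeration

    T-vanishes : ∀ i → T (element i) ≈ 0#
    T-vanishes i with T≈0⊎T≈1 (element i)
    ... | inj₁ T≈0 = T≈0
    ... | inj₂ T≈1 = contradiction (i , T≈1) T≉1


  -- Square roots and algebraic identities for `v * L a b v`.

  T-0 : T 0# ≈ 0#
  T-0 = +-cancelʳ (T 0#) _ _ (begin
    T 0# + T 0#   ≈⟨ T-+ 0# 0# ⟨
    T (0# + 0#)   ≈⟨ T-cong (+-identityˡ 0#) ⟩
    T 0#          ≈⟨ +-identityˡ _ ⟨
    0# + T 0#     ∎)

  sqrt : ∀ b → ∃ λ β → β ^ 2 ≈ b
  -- Squaring `2m` times is the identity, so squaring `2m - 1` times yields a square root.
  sqrt b = b ^ (2 ^ℕ k) , (begin
    (b ^ (2 ^ℕ k)) ^ 2         ≈⟨ ^-assocʳ b (2 ^ℕ k) 2 ⟩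
    b ^ (2 ^ℕ k ℕ.* 2)         ≡⟨ ≡.cong (b ^_) (≡.trans (ℕ.*-comm (2 ^ℕ k) 2) (≡.cong (2 ^ℕ_) 1+k≡2m)) ⟩
    b ^ (2 ^ℕ (2 ℕ.* m))       ≈⟨ x^2^2m≈x b ⟩
    b                          ∎)

  -- Were `0# ^ q` nonzero, its `q`-th power would be too, but that power is `0#`.
  0^q≈0 : 0# ^ q ≈ 0#
  0^q≈0 with 0# ^ q ≟ 0#
  ... | yes eq = eq
  ... | no neq = contradiction (x^q^q≈x 0#) (^-≉0 q neq)

  -- The cross term `b * v * u` arises twice and cancels in characteristic 2; only the cross terms
  -- with `a` survive.
  L-+ : ∀ a b v u → (v + u) * L a b (v + u) ≈ v * L a b v + (u * L a b u + (a * v ^ q * u + a * u ^ q * v))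
  L-+ a b v u = begin
    (v + u) * (a * (v + u) ^ q + b * (v + u))
      ≈⟨ *-congˡ (+-congʳ (*-congˡ (frobenius-+ m v u))) ⟩
    (v + u) * (a * (v ^ q + u ^ q) + b * (v + u))
      ≈⟨ solve 6 (λ a b v u v′ u′ → (v :+ u) :* (a :* (v′ :+ u′) :+ b :* (v :+ u))
           := (v :* (a :* v′ :+ b :* v) :+ (u :* (a :* u′ :+ b :* u) :+ (a :* v′ :* u :+ a :* u′ :* v)))
              :+ (b :* v :* u :+ b :* v :* u)) refl a b v u (v ^ q) (u ^ q) ⟩
    v * L a b v + (u * L a b u + (a * v ^ q * u + a * u ^ q * v)) + (b * v * u + b * v * u)
      ≈⟨ trans (+-congˡ (x+x≈0 _)) (+-identityʳ _) ⟩
    v * L a b v + (u * L a b u + (a * v ^ q * u + a * u ^ q * v))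
      ∎

  -- Since `(v ^ q) ^ q` is `v`, conjugation makes the first cross term of `L-+` linear in `v`, so
  -- that it can be merged with the second.
  conjugate : ∀ a v u → (a * v ^ q * u) ^ q ≈ a ^ q * u ^ q * v
  conjugate a v u = begin
    (a * v ^ q * u) ^ q              ≈⟨ ^-distrib-* (a * v ^ q) u q ⟩
    (a * v ^ q) ^ q * u ^ q          ≈⟨ *-congʳ (^-distrib-* a (v ^ q) q) ⟩
    a ^ q * (v ^ q) ^ q * u ^ q      ≈⟨ *-congʳ (*-congˡ (x^q^q≈x v)) ⟩
    a ^ q * v * u ^ q                ≈⟨ solve 3 (λ x y z → x :* y :* z := x :* z :* y) refl (a ^ q) v (u ^ q) ⟩
    a ^ q * u ^ q * v                ∎

  -- Separates the norm of `v` to the subfield, scaled by `a`, from a square, which `χ` cannot tell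
  -- from its root.
  L-split : ∀ a {b} β → β ^ 2 ≈ b → ∀ v → v * L a b v ≈ a * (v ^ q * v) + (β * v) ^ 2
  L-split a {b} β β²≈b v = begin
    v * (a * v ^ q + b * v)
      ≈⟨ *-congˡ (+-congˡ (*-congʳ β²≈b)) ⟨
    v * (a * v ^ q + β ^ 2 * v)
      ≈⟨ solve 4 (λ v a w β → v :* (a :* w :+ (β :* (β :* con 1)) :* v)
           := a :* (w :* v) :+ (β :* v) :* ((β :* v) :* con 1)) refl v a (v ^ q) β ⟩
    a * (v ^ q * v) + (β * v) ^ 2
      ∎

  -- In characteristic 2 the hypothesis says that `a` is fixed by the `q`-th power, which merely
  -- swaps the factors of `v ^ q * v`.
  norm-fixed : ∀ {a} → a ^ q + a ≈ 0# → ∀ v → (a * (v ^ q * v)) ^ q ≈ a * (v ^ q * v)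
  norm-fixed {a} a^q+a≈0 v = begin
    (a * (v ^ q * v)) ^ q           ≈⟨ ^-distrib-* a (v ^ q * v) q ⟩
    a ^ q * (v ^ q * v) ^ q         ≈⟨ *-cong (x+y≈0⇒x≈y a^q+a≈0) (^-distrib-* (v ^ q) v q) ⟩
    a * ((v ^ q) ^ q * v ^ q)       ≈⟨ *-congˡ (*-congʳ (x^q^q≈x v)) ⟩
    a * (v * v ^ q)                 ≈⟨ *-congˡ (*-comm v (v ^ q)) ⟩
    a * (v ^ q * v)                 ∎

-- The additive character and its sums.

module CharacterSumProperties {r ℓ} (m : ℕ) .{{_ : NonZero m}} (F : FiniteField r ℓ ((2 ^ℕ m) ^ℕ 2)) where
  open FiniteField F hiding (zero)
  open CharacterSum m F
  open FiniteFieldProperties F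
  open TraceProperties m F
  open CommutativeSemiringExp commutativeSemiring using (^-congˡ)
  open NaturalSolver commutativeSemiring
  open FieldSum F ℤ.+-0-commutativeMonoid
  open SemiringSum ℤ.+-*-semiring using (*-distribˡ-sum)
  open RawMonoidDefs ℤ.+-0-rawMonoid using () renaming (_×_ to _·_)
  open ≡.≡-Reasoning

  χ≡1 : ∀ {v} → T v ≈ 0# → χ v ≡ 1ℤ
  χ≡1 {v} T≈0 with T v ≟ 0#
  ... | yes _  = ≡.refl
  ... | no T≉0 = contradiction T≈0 T≉0

  χ≡-1 : ∀ {v} → T v ≈ 1# → χ v ≡ -1ℤ
  χ≡-1 {v} T≈1 with T v ≟ 0#
  ... | yes T≈0 = contradiction (trans (sym T≈1) T≈0) 1≉0
  ... | no _    = ≡.refl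

  -- Transfers to `χ` the invariance of `T` under `≈`, squaring and the `q`-th power.
  χ-resp-T : ∀ {v w} → T v ≈ T w → χ v ≡ χ w
  χ-resp-T {v} {w} Tv≈Tw with T≈0⊎T≈1 w
  ... | inj₁ T≈0 = ≡.trans (χ≡1 (trans Tv≈Tw T≈0)) (≡.sym (χ≡1 T≈0))
  ... | inj₂ T≈1 = ≡.trans (χ≡-1 (trans Tv≈Tw T≈1)) (≡.sym (χ≡-1 T≈1))

  χ-cong : ∀ {v w} → v ≈ w → χ v ≡ χ w
  χ-cong v≈w = χ-resp-T (T-cong v≈w)

  χ-0 : χ 0# ≡ 1ℤ
  χ-0 = χ≡1 T-0

  χ-+ : ∀ v w → χ (v + w) ≡ χ v ℤ.* χ w
  χ-+ v w with T≈0⊎T≈1 v | T≈0⊎T≈1 w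
  ... | inj₁ Tv | inj₁ Tw = ≡.trans (χ≡1 (trans (T-+ v w) (trans (+-cong Tv Tw) (+-identityˡ 0#))))
                              (≡.sym (≡.cong₂ ℤ._*_ (χ≡1 Tv) (χ≡1 Tw)))
  ... | inj₁ Tv | inj₂ Tw = ≡.trans (χ≡-1 (trans (T-+ v w) (trans (+-cong Tv Tw) (+-identityˡ 1#))))
                              (≡.sym (≡.cong₂ ℤ._*_ (χ≡1 Tv) (χ≡-1 Tw)))
  ... | inj₂ Tv | inj₁ Tw = ≡.trans (χ≡-1 (trans (T-+ v w) (trans (+-cong Tv Tw) (+-identityʳ 1#))))
                              (≡.sym (≡.cong₂ ℤ._*_ (χ≡-1 Tv) (χ≡1 Tw)))
  ... | inj₂ Tv | inj₂ Tw = ≡.trans (χ≡1 (trans (T-+ v w) (trans (+-cong Tv Tw) (x+x≈0 1#))))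
                              (≡.sym (≡.cong₂ ℤ._*_ (χ≡-1 Tv) (χ≡-1 Tw)))

  χ² : ∀ v → χ v ℤ.* χ v ≡ 1ℤ
  χ² v = ≡.trans (≡.sym (χ-+ v v)) (≡.trans (χ-cong (x+x≈0 v)) χ-0)

  χ-square : ∀ v → χ (v ^ 2) ≡ χ v
  χ-square v = χ-resp-T (T-square v)

  χ-^q : ∀ v → χ (v ^ q) ≡ χ v
  χ-^q v = χ-resp-T (T-frobenius m v)

  *-distribˡ-∑ : ∀ x f → x ℤ.* ∑ f ≡ ∑ (λ v → x ℤ.* f v)
  *-distribˡ-∑ x f = *-distribˡ-sum x (f ∘ element)

  ∑1≡q² : ∑ (λ _ → 1ℤ) ≡ ℤ.+ (q ^ℕ 2)
  ∑1≡q² = ≡.trans (∑-const 1ℤ) (k·1 (q ^ℕ 2))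
    where
    k·1 : ∀ k → k · 1ℤ ≡ ℤ.+ k
    k·1 ℕ.zero    = ≡.refl
    k·1 (ℕ.suc k) = ≡.cong ℤ.suc (k·1 k)

  ∑1≢0 : ∑ (λ _ → 1ℤ) ≢ 0ℤ
  ∑1≢0 eq = ℕ.≢-nonZero⁻¹ (q ^ℕ 2) {{ℕ.m^n≢0 q 2 {{ℕ.m^n≢0 2 m}}}}
    (ℤ.+-injective (≡.trans (≡.sym ∑1≡q²) eq))

  -- Translating `v` by `c⁻¹ * w`, where `w` has trace `1#`, flips the sign of every term, so the
  -- sum equals its own negative.
  ∑χ≡0 : ∀ {c} → ¬ c ≈ 0# → ∑ (λ v → χ (c * v)) ≡ 0ℤ
  ∑χ≡0 {c} c≉0
    with w , Tw≈1 ← T-surjective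
    with c⁻¹ , _ , cc⁻¹≈1 ← ≉0⇒invertible c c≉0 = i≡-i⇒i≡0 (begin
      ∑ (λ v → χ (c * v))                  ≡⟨ ∑-translate (χ-cong ∘ *-congˡ) (c⁻¹ * w) ⟩
      ∑ (λ v → χ (c * (v + c⁻¹ * w)))      ≡⟨ ∑-cong shift ⟩
      ∑ (λ v → -1ℤ ℤ.* χ (c * v))          ≡⟨ *-distribˡ-∑ -1ℤ (λ v → χ (c * v)) ⟨
      -1ℤ ℤ.* ∑ (λ v → χ (c * v))          ≡⟨ ℤ.-1*i≡-i _ ⟩
      ℤ.- ∑ (λ v → χ (c * v))              ∎)
    where
    shift : ∀ v → χ (c * (v + c⁻¹ * w)) ≡ -1ℤ ℤ.* χ (c * v)
    shift v = begin
      χ (c * (v + c⁻¹ * w))        ≡⟨ χ-cong (solve 4 (λ c c⁻¹ v w →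
                                        c :* (v :+ c⁻¹ :* w) := (c :* c⁻¹) :* w :+ c :* v) refl c c⁻¹ v w) ⟩
      χ (c * c⁻¹ * w + c * v)      ≡⟨ χ-+ _ _ ⟩
      χ (c * c⁻¹ * w) ℤ.* χ (c * v)
        ≡⟨ ≡.cong (ℤ._* χ (c * v)) (≡.trans (χ-cong (trans (*-congʳ cc⁻¹≈1) (*-identityˡ w))) (χ≡-1 Tw≈1)) ⟩
      -1ℤ ℤ.* χ (c * v)            ∎

  -- Evaluation of `𝒮 (L a b)`.

  module _ (a b : Carrier) where

    -- `𝒮 (L a b)` unfolds to `∑ ψ`, so the lemmas on `∑` apply to it directly.
    ψ : Carrier → ℤ
    ψ v = χ (v * L a b v)

    ψ-cong : ∀ {v w} → v ≈ w → ψ v ≡ ψ w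
    ψ-cong v≈w = χ-cong (*-cong v≈w (+-cong (*-congˡ (^-congˡ q v≈w)) (*-congˡ v≈w)))

    -- For fixed `u` the last factor is an additive character of `v`, so a sum over `v` falls under
    -- `∑χ≡0`.
    ψ-+ : ∀ v u → ψ (v + u) ≡ ψ v ℤ.* (ψ u ℤ.* χ ((a ^ q + a) * u ^ q * v))
    ψ-+ v u = begin
      ψ (v + u)
        ≡⟨ χ-cong (L-+ a b v u) ⟩
      χ (v * L a b v + (u * L a b u + (a * v ^ q * u + a * u ^ q * v)))
        ≡⟨ χ-+ _ _ ⟩
      ψ v ℤ.* χ (u * L a b u + (a * v ^ q * u + a * u ^ q * v))
        ≡⟨ ≡.cong (ψ v ℤ.*_) (χ-+ _ _) ⟩
      ψ v ℤ.* (ψ u ℤ.* χ (a * v ^ q * u + a * u ^ q * v))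
        ≡⟨ ≡.cong (λ z → ψ v ℤ.* (ψ u ℤ.* z)) polar ⟩
      ψ v ℤ.* (ψ u ℤ.* χ ((a ^ q + a) * u ^ q * v))
        ∎
      where
      polar : χ (a * v ^ q * u + a * u ^ q * v) ≡ χ ((a ^ q + a) * u ^ q * v)
      polar = begin
        χ (a * v ^ q * u + a * u ^ q * v)
          ≡⟨ χ-+ _ _ ⟩
        χ (a * v ^ q * u) ℤ.* χ (a * u ^ q * v)
          -- `χ` does not notice a `q`-th power, which moves the exponent `q` from `v` to `u`.
          ≡⟨ ≡.cong (ℤ._* χ (a * u ^ q * v)) (≡.trans (≡.sym (χ-^q _)) (χ-cong (conjugate a v u))) ⟩
        χ (a ^ q * u ^ q * v) ℤ.* χ (a * u ^ q * v)
          ≡⟨ χ-+ _ _ ⟨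
        χ (a ^ q * u ^ q * v + a * u ^ q * v)
          ≡⟨ χ-cong (solve 4 (λ x a y z → x :* y :* z :+ a :* y :* z := (x :+ a) :* y :* z) refl (a ^ q) a (u ^ q) v) ⟩
        χ ((a ^ q + a) * u ^ q * v)
          ∎

    module _ (a^q+a≉0 : ¬ a ^ q + a ≈ 0#) where

      𝒮²≡∑1 : 𝒮 (L a b) ℤ.* 𝒮 (L a b) ≡ ∑ (λ _ → 1ℤ)
      𝒮²≡∑1 = begin
        ∑ ψ ℤ.* ∑ ψ                                ≡⟨ *-distribˡ-∑ (∑ ψ) ψ ⟩
        ∑ (λ v → ∑ ψ ℤ.* ψ v)                      ≡⟨ ∑-cong expand ⟩
        ∑ (λ v → ∑ (λ u → ψ u ℤ.* χ (c * u ^ q * v)))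
          ≡⟨ ∑-swap (λ v u → ψ u ℤ.* χ (c * u ^ q * v)) ⟩
        ∑ (λ u → ∑ (λ v → ψ u ℤ.* χ (c * u ^ q * v)))
          ≡⟨ ∑-cong (λ u → ≡.sym (*-distribˡ-∑ (ψ u) (λ v → χ (c * u ^ q * v)))) ⟩
        ∑ inner                                    ≡⟨ ∑-single inner-cong 0# vanish ⟩
        inner 0#                                   ≡⟨ ≡.cong₂ ℤ._*_ (≡.trans (χ-cong (zeroˡ _)) χ-0) (∑-cong at-0) ⟩
        1ℤ ℤ.* ∑ (λ _ → 1ℤ)                        ≡⟨ ℤ.*-identityˡ _ ⟩
        ∑ (λ _ → 1ℤ)                               ∎
        where
        c : Carrier
        c = a ^ q + a

        inner : Carrier → ℤ
        inner u = ψ u ℤ.* ∑ (λ v → χ (c * u ^ q * v))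

        inner-cong : ∀ {u w} → u ≈ w → inner u ≡ inner w
        inner-cong u≈w = ≡.cong₂ ℤ._*_ (ψ-cong u≈w)
          (∑-cong λ v → χ-cong (*-congʳ {v} (*-congˡ (^-congˡ q u≈w))))

        expand : ∀ v → ∑ ψ ℤ.* ψ v ≡ ∑ (λ u → ψ u ℤ.* χ (c * u ^ q * v))
        expand v = begin
          ∑ ψ ℤ.* ψ v                      ≡⟨ ℤ.*-comm (∑ ψ) (ψ v) ⟩
          -- The second summation variable is replaced by `u + v`, with `v` fixed, so that `ψ-+`
          -- applies.
          ψ v ℤ.* ∑ ψ                      ≡⟨ ≡.cong (ψ v ℤ.*_) (∑-translate ψ-cong v) ⟩
          ψ v ℤ.* ∑ (λ u → ψ (u + v))      ≡⟨ *-distribˡ-∑ (ψ v) (λ u → ψ (u + v)) ⟩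
          ∑ (λ u → ψ v ℤ.* ψ (u + v))      ≡⟨ ∑-cong collapse ⟩
          ∑ (λ u → ψ u ℤ.* χ (c * u ^ q * v)) ∎
          where
          collapse : ∀ u → ψ v ℤ.* ψ (u + v) ≡ ψ u ℤ.* χ (c * u ^ q * v)
          collapse u = begin
            ψ v ℤ.* ψ (u + v)        ≡⟨ ≡.cong (ψ v ℤ.*_) (≡.trans (ψ-cong (+-comm u v)) (ψ-+ v u)) ⟩
            -- The sign `ψ v` occurs twice and squares to `1ℤ`.
            ψ v ℤ.* (ψ v ℤ.* z)      ≡⟨ ℤ.*-assoc (ψ v) (ψ v) z ⟨
            ψ v ℤ.* ψ v ℤ.* z        ≡⟨ ≡.cong (ℤ._* z) (χ² _) ⟩
            1ℤ ℤ.* z                 ≡⟨ ℤ.*-identityˡ z ⟩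
            z                        ∎
            where z = ψ u ℤ.* χ (c * u ^ q * v)

        vanish : ∀ u → ¬ u ≈ 0# → inner u ≡ 0ℤ
        vanish u u≉0 = ≡.trans (≡.cong (ψ u ℤ.*_) (∑χ≡0 (*-≉0 a^q+a≉0 (^-≉0 q u≉0)))) (ℤ.*-zeroʳ (ψ u))

        at-0 : ∀ v → χ (c * 0# ^ q * v) ≡ 1ℤ
        at-0 v = ≡.trans (χ-cong c0v≈0) χ-0
          where
          c0v≈0 : c * 0# ^ q * v ≈ 0#
          c0v≈0 = trans (*-congʳ (trans (*-congˡ 0^q≈0) (zeroʳ c))) (zeroˡ v)

      𝒮≢0 : 𝒮 (L a b) ≢ 0ℤ
      𝒮≢0 𝒮≡0 = ∑1≢0 (≡.trans (≡.sym 𝒮²≡∑1) (≡.cong (λ s → s ℤ.* s) 𝒮≡0))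

    module _ (a^q+a≈0 : a ^ q + a ≈ 0#) where

      𝒮≡∑χ : ∀ {β} → β ^ 2 ≈ b → 𝒮 (L a b) ≡ ∑ (λ v → χ (β * v))
      𝒮≡∑χ {β} β²≈b = ∑-cong {ψ} λ v → begin
        χ (v * (a * v ^ q + b * v))
          ≡⟨ χ-cong (L-split a β β²≈b v) ⟩
        χ (a * (v ^ q * v) + (β * v) ^ 2)
          ≡⟨ χ-+ _ _ ⟩
        χ (a * (v ^ q * v)) ℤ.* χ ((β * v) ^ 2)
          -- The norm part is fixed by the `q`-th power, hence has trace zero and contributes the
          -- factor `1ℤ`.
          ≡⟨ ≡.cong₂ ℤ._*_ (χ≡1 (T-subfield _ (norm-fixed a^q+a≈0 v))) (χ-square (β * v)) ⟩
        1ℤ ℤ.* χ (β * v)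
          ≡⟨ ℤ.*-identityˡ _ ⟩
        χ (β * v)
          ∎

      -- For `b` zero, `0#` serves as the square root `β`. Every term is then `χ 0#`, that is `1ℤ`,
      -- and the sum is the nonzero number of elements.
      𝒮≡0⇒b≉0 : 𝒮 (L a b) ≡ 0ℤ → ¬ b ≈ 0#
      𝒮≡0⇒b≉0 𝒮≡0 b≈0 = ∑1≢0 (≡.trans
        (∑-cong λ v → ≡.sym (≡.trans (χ-cong (zeroˡ v)) χ-0))
        (≡.trans (≡.sym (𝒮≡∑χ (trans (zeroˡ _) (sym b≈0)))) 𝒮≡0))

      b≉0⇒𝒮≡0 : ¬ b ≈ 0# → 𝒮 (L a b) ≡ 0ℤ
      b≉0⇒𝒮≡0 b≉0 with β , β²≈b ← sqrt b = ≡.trans (𝒮≡∑χ β²≈b)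
        -- The root `β` is nonzero because its square `b` is.
        (∑χ≡0 λ β≈0 → b≉0 (trans (sym β²≈b) (trans (*-congʳ β≈0) (zeroˡ _))))

    𝒮≡0⇒a^q+a≈0 : 𝒮 (L a b) ≡ 0ℤ → a ^ q + a ≈ 0#
    𝒮≡0⇒a^q+a≈0 𝒮≡0 with a ^ q + a ≟ 0#
    ... | yes a^q+a≈0 = a^q+a≈0
    ... | no a^q+a≉0  = contradiction 𝒮≡0 (𝒮≢0 a^q+a≉0)

theorem4 : ∀ {c ℓ} (m : ℕ) .{{_ : NonZero m}} (F : FiniteField c ℓ ((2 ^ℕ m) ^ℕ 2)) →
    let open FiniteField F
        open CharacterSum m F
    in (a b : Carrier) →
       (𝒮 (L a b) ≡ 0ℤ) ⇔ ((a ^ q + a ≈ 0#) × ¬ (b ≈ 0#))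
theorem4 m F a b = mk⇔
  (λ 𝒮≡0 → let a^q+a≈0 = 𝒮≡0⇒a^q+a≈0 a b 𝒮≡0 in a^q+a≈0 , 𝒮≡0⇒b≉0 a b a^q+a≈0 𝒮≡0)
  (λ (a^q+a≈0 , b≉0) → b≉0⇒𝒮≡0 a b a^q+a≈0 b≉0)
  where open CharacterSumProperties m F
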